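{- If $M$ is a matroid of rank $4$ that is OTE, then $M$ is sticky.
   Context: A modular cut of a matroid $M$ is a set $\mathcal{M}$ of flats of $M$ such that (1) if $F\in\mathcal{M}$ and $F'\supseteq F$ is a flat, then $F'\in\mathcal{M}$; (2) if $F_1,F_2\in\mathcal{M}$ and $(F_1,F_2)$ is a modular pair, i.e. $\operatorname{rk}(F_1)+\operatorname{rk}(F_2)=\operatorname{rk}(F_1\cup F_2)+\operatorname{rk}(F_1\cap F_2)$, then $F_1\cap F_2\in\mathcal{M}$. For a flat $F$, the principal modular cut is $\mathcal{M}_F=\{G: G \text{ a flat of } M, G\supseteq F\}$. A matroid is OTE (only trivially extendable) if every modular cut other than the empty modular cut is principal. An extension of a matroid $M$ on $E$ is a matroid $N$ on $F\supseteq E$ with $N|E=M$. If $N_1,N_2$ are extensions of $M$ on ground sets $F_1,F_2$ with $F_1\cap F_2=E$, an amalgam of $N_1,N_2$ is a matroid on $F_1\cup F_2$ whose restriction to $F_i$ is $N_i$ ($i=1,2$). $M$ is sticky if an amalgam exists for every such pair of extensions. -}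

module Defs where

open import Data.Nat using (ℕ; _≤_; _<_; _+_)
open import Data.Bool using (Bool; true; false)
open import Data.Fin.Subset
  using (Subset; _∪_; _∩_; ⁅_⁆; _⊆_; _∉_; ∣_∣)
  renaming (⊥ to ∅; ⊤ to Full)
open import Data.Vec using (_++_)
open import Data.Product using (Σ; _×_)
open import Data.Sum using (_⊎_)
open import Relation.Binary.PropositionalEquality using (_≡_)

record Matroid (n : ℕ) : Set where
  field
    rk        : Subset n → ℕ
    rk-bound  : ∀ X → rk X ≤ ∣ X ∣
    rk-mono   : ∀ X Y → X ⊆ Y → rk X ≤ rk Y
    rk-submod : ∀ X Y → rk (X ∪ Y) + rk (X ∩ Y) ≤ rk X + rk Y
open Matroid public

rank : ∀ {n} → Matroid n → ℕ
rank M = rk M Full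

IsFlat : ∀ {n} → Matroid n → Subset n → Set
IsFlat {n} M F = ∀ e → e ∉ F → rk M F < rk M (F ∪ ⁅ e ⁆)

IsModularPair : ∀ {n} → Matroid n → Subset n → Subset n → Set
IsModularPair M F₁ F₂ = rk M F₁ + rk M F₂ ≡ rk M (F₁ ∪ F₂) + rk M (F₁ ∩ F₂)

record IsModularCut {n} (M : Matroid n) (𝓜 : Subset n → Bool) : Set where
  field
    only-flats : ∀ F → 𝓜 F ≡ true → IsFlat M F
    up-closed  : ∀ F F′ → 𝓜 F ≡ true → IsFlat M F′ → F ⊆ F′ → 𝓜 F′ ≡ true
    modular    : ∀ F₁ F₂ → 𝓜 F₁ ≡ true → 𝓜 F₂ ≡ true →
                 IsModularPair M F₁ F₂ → 𝓜 (F₁ ∩ F₂) ≡ true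

IsEmptyCut : ∀ {n} → (Subset n → Bool) → Set
IsEmptyCut 𝓜 = ∀ F → 𝓜 F ≡ false

IsPrincipalCut : ∀ {n} → Matroid n → (Subset n → Bool) → Set
IsPrincipalCut {n} M 𝓜 =
  Σ (Subset n) λ F → IsFlat M F ×
    (∀ G → (𝓜 G ≡ true → IsFlat M G × F ⊆ G) × (IsFlat M G × F ⊆ G → 𝓜 G ≡ true))

-- only trivially extendable
OTE : ∀ {n} → Matroid n → Set
OTE {n} M = ∀ (𝓜 : Subset n → Bool) → IsModularCut M 𝓜 → IsEmptyCut 𝓜 ⊎ IsPrincipalCut M 𝓜

-- N on Fin (n + k) (= E ⊎ k new elements) is an extension of M: N | E = M
IsExtension : ∀ {n k} → Matroid n → Matroid (n + k) → Set
IsExtension {n} {k} M N = ∀ (X : Subset n) → rk N (X ++ ∅) ≡ rk M X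

-- A on Fin (n + (k₁ + k₂)) = E ⊎ F₁∖E ⊎ F₂∖E is an amalgam of N₁ and N₂
IsAmalgam : ∀ {n k₁ k₂} → Matroid (n + k₁) → Matroid (n + k₂) → Matroid (n + (k₁ + k₂)) → Set
IsAmalgam {n} {k₁} {k₂} N₁ N₂ A =
  (∀ (Y : Subset n) (Z : Subset k₁) → rk A (Y ++ (Z ++ ∅)) ≡ rk N₁ (Y ++ Z)) ×
  (∀ (Y : Subset n) (Z : Subset k₂) → rk A (Y ++ (∅ ++ Z)) ≡ rk N₂ (Y ++ Z))

Sticky : ∀ {n} → Matroid n → Set
Sticky {n} M = ∀ k₁ k₂ (N₁ : Matroid (n + k₁)) (N₂ : Matroid (n + k₂)) →
  IsExtension M N₁ → IsExtension M N₂ → Σ (Matroid (n + (k₁ + k₂))) (IsAmalgam {n} {k₁} {k₂} N₁ N₂)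

{-# OPTIONS --safe #-}
module Submission where

-- With E the ground set of M and r its rank, put η(S) = r₁(S) + r₂(S) - r(S ∩ E), where
-- r₁, r₂ are the ranks of N₁, N₂ with the missing elements added as loops.  The amalgam has
-- rank function S ↦ min {η(W) : W ⊇ S}; only submodularity is an issue.  The minima
-- are attained at sets X, Y closed in both extensions under elements of E, so it
-- suffices to find V ⊇ X ∩ Y and W ⊇ X ∪ Y with η(V) + η(W) ≤ η(X) + η(Y).
-- V = X ∩ Y and W = X ∪ Y work if the traces x, y of X, Y on E are a modular pair, or if
-- they have defect one and X, Y is not a modular pair in r₁ or in r₂.  By OTE two planes
-- are always a modular pair, so otherwise x is a line and y a disjoint line
-- coplanar with x, or a disjoint plane (up to symmetry).  By OTE again, contracting
-- Z = X ∩ Y in either extension drops the rank of E by at least two: with a drop of one, the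
-- flats of M whose rank drops would form a modular cut containing x and y but not x ∩ y.
-- Then V = Z, W = X ∪ Y ∪ E works for two lines, and V = Z ∪ y, W = X ∪ Y for a line and a plane.

open import Defs
open import Data.Bool using (true)
import Data.Bool.Properties as Bool
open import Data.Fin using (Fin)
open import Data.Fin.Properties using (all?)
open import Data.Fin.Subset
  using (Subset; inside; outside; _∪_; _∩_; ⁅_⁆; _∈_; _⊆_; _⊃_; ∣_∣)
  renaming (⊥ to ∅; ⊤ to Full)
open import Data.Fin.Subset.Induction using (Acc; acc; ⊃-wellFounded)
open import Data.Fin.Subset.Properties
open import Data.Nat using (ℕ; zero; suc; _+_; _∸_; _⊓_; _≤_; _<_; z≤n; s≤s; _≤?_; _<?_)
open import Data.Nat.Properties
open import Data.Nat.Tactic.RingSolver using (solve-∀)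
open import Data.Product using (∃; _×_; _,_; proj₁; proj₂)
open import Data.Sum using (_⊎_; inj₁; inj₂; [_,_]′)
open import Data.Vec using (_++_; take; drop; zipWith; []; _∷_; here)
open import Data.Vec.Properties
  using (take-zipWith; drop-zipWith; take++drop≡id; zipWith-++; ++-injectiveˡ; ++-injectiveʳ; ≡-dec)
open import Function using (_∘_)
open import Relation.Binary.PropositionalEquality
open import Relation.Nullary using (¬_; Dec; yes; no; ¬?; contradiction; does)
open import Relation.Nullary.Decidable using (_×-dec_; _⊎-dec_; _→-dec_; decidable-stable; dec-true)

-- Inclusions of subsets and traces on `E`.

⊆⇒∩≡ : ∀ {m} {A B : Subset m} → A ⊆ B → A ∩ B ≡ A
⊆⇒∩≡ {A = A} {B} A⊆B = ⊆-antisym (p∩q⊆p A B) λ x∈A → x∈p∩q⁺ (x∈A , A⊆B x∈A)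

-- As an equation, an inclusion passes through any map that commutes with `_∩_`; this gives
-- monotonicity for `take`, `_++_` and `pullback`.
∩≡⇒⊆ : ∀ {m} {A B : Subset m} → A ∩ B ≡ A → A ⊆ B
∩≡⇒⊆ {A = A} {B} eq x∈A = p∩q⊆q A B (subst (_ ∈_) (sym eq) x∈A)

∪-lub : ∀ {m} {A B C : Subset m} → A ⊆ C → B ⊆ C → A ∪ B ⊆ C
∪-lub {A = A} {B} A⊆C B⊆C x∈ = [ A⊆C , B⊆C ]′ (x∈p∪q⁻ A B x∈)

∩-glb : ∀ {m} {A B C : Subset m} → C ⊆ A → C ⊆ B → C ⊆ A ∩ B
∩-glb C⊆A C⊆B x∈ = x∈p∩q⁺ (C⊆A x∈ , C⊆B x∈)

∪-mono : ∀ {m} {A B C D : Subset m} → A ⊆ C → B ⊆ D → A ∪ B ⊆ C ∪ D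
∪-mono {C = C} {D} A⊆C B⊆D = ∪-lub (λ x∈ → p⊆p∪q D (A⊆C x∈)) (λ x∈ → q⊆p∪q C D (B⊆D x∈))

∩-mono : ∀ {m} {A B C D : Subset m} → A ⊆ C → B ⊆ D → A ∩ B ⊆ C ∩ D
∩-mono {A = A} {B} A⊆C B⊆D = ∩-glb (λ x∈ → A⊆C (p∩q⊆p A B x∈)) (λ x∈ → B⊆D (p∩q⊆q A B x∈))

⁅⁆⊆ : ∀ {m} {e : Fin m} {A : Subset m} → e ∈ A → ⁅ e ⁆ ⊆ A
⁅⁆⊆ {e = e} e∈A x∈ = subst (_∈ _) (sym (x∈⁅y⁆⇒x≡y e x∈)) e∈A

take-++ : ∀ {m n} (A : Subset m) (B : Subset n) → take m (A ++ B) ≡ A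
take-++ {m} A B = ++-injectiveˡ (take m (A ++ B)) A (take++drop≡id m (A ++ B))

drop-++ : ∀ {m n} (A : Subset m) (B : Subset n) → drop m (A ++ B) ≡ B
drop-++ {m} A B = ++-injectiveʳ (take m (A ++ B)) A (take++drop≡id m (A ++ B))

take-mono : ∀ {n k} {A B : Subset (n + k)} → A ⊆ B → take n A ⊆ take n B
take-mono {n} {A = A} {B} A⊆B = ∩≡⇒⊆ (trans (sym (take-zipWith {m = n} _ A B)) (cong (take n) (⊆⇒∩≡ A⊆B)))

++-mono : ∀ {n k} {A B : Subset n} {C D : Subset k} → A ⊆ B → C ⊆ D → A ++ C ⊆ B ++ D
++-mono {A = A} {B} {C} {D} A⊆B C⊆D =
  ∩≡⇒⊆ (trans (zipWith-++ _ A C B D) (cong₂ _++_ (⊆⇒∩≡ A⊆B) (⊆⇒∩≡ C⊆D)))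

∣++∣ : ∀ {n k} (A : Subset n) (B : Subset k) → ∣ A ++ B ∣ ≡ ∣ A ∣ + ∣ B ∣
∣++∣ []            B = refl
∣++∣ (outside ∷ A) B = ∣++∣ A B
∣++∣ (inside ∷ A)  B = cong suc (∣++∣ A B)

-- The embedding ι of subsets of E into subsets of E ⊎ K, and its right adjoint τ.
module Trace (n k : ℕ) where

  ι : Subset n → Subset (n + k)
  ι F = F ++ ∅

  τ : Subset (n + k) → Subset n
  τ = take n

  ι-mono : ∀ {A B} → A ⊆ B → ι A ⊆ ι B
  ι-mono A⊆B = ++-mono {C = ∅} A⊆B ⊆-refl

  ι-∪⊆ : ∀ A B → ι (A ∪ B) ⊆ ι A ∪ ι B
  ι-∪⊆ A B = ⊆-reflexive (sym (trans (zipWith-++ _ A ∅ B ∅) (cong (A ∪ B ++_) (∪-idem {k} ∅))))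

  τ-ι : ∀ A → τ (ι A) ≡ A
  τ-ι A = take-++ A ∅

  τ-mono : ∀ {S T} → S ⊆ T → τ S ⊆ τ T
  τ-mono = take-mono

  τ-∪ : ∀ S T → τ (S ∪ T) ≡ τ S ∪ τ T
  τ-∪ S T = take-zipWith _ S T

  τ-∩ : ∀ S T → τ (S ∩ T) ≡ τ S ∩ τ T
  τ-∩ S T = take-zipWith _ S T

  ι⊆⇒⊆τ : ∀ {F S} → ι F ⊆ S → F ⊆ τ S
  ι⊆⇒⊆τ {F} {S} ιF⊆S = subst (_⊆ τ S) (τ-ι F) (τ-mono ιF⊆S)

  ⊆τ⇒ι⊆ : ∀ {F S} → F ⊆ τ S → ι F ⊆ S
  ⊆τ⇒ι⊆ {F} {S} F⊆τS = subst (ι F ⊆_) (take++drop≡id n S) (++-mono F⊆τS (⊆-min (drop n S)))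

  ιτ⊆ : ∀ S → ι (τ S) ⊆ S
  ιτ⊆ S = ⊆τ⇒ι⊆ ⊆-refl

-- Minima of set functions over supersets.

min⊇ : ∀ {m} → (Subset m → ℕ) → Subset m → ℕ
min⊇ f []            = f []
min⊇ f (inside ∷ A)  = min⊇ (f ∘ (inside ∷_)) A
min⊇ f (outside ∷ A) = min⊇ (f ∘ (outside ∷_)) A ⊓ min⊇ (f ∘ (inside ∷_)) A

min⊇-lower : ∀ {m} (f : Subset m → ℕ) {A W} → A ⊆ W → min⊇ f A ≤ f W
min⊇-lower f {[]}          {[]}          A⊆W = ≤-refl
min⊇-lower f {inside ∷ A}  {inside ∷ W}  A⊆W = min⊇-lower _ (drop-∷-⊆ A⊆W)
min⊇-lower f {inside ∷ A}  {outside ∷ W} A⊆W with () ← A⊆W here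
min⊇-lower f {outside ∷ A} {inside ∷ W}  A⊆W = ≤-trans (m⊓n≤n _ _) (min⊇-lower _ (drop-∷-⊆ A⊆W))
min⊇-lower f {outside ∷ A} {outside ∷ W} A⊆W = ≤-trans (m⊓n≤m _ _) (min⊇-lower _ (drop-∷-⊆ A⊆W))

min⊇-attained : ∀ {m} (f : Subset m → ℕ) A → ∃ λ W → A ⊆ W × f W ≡ min⊇ f A
min⊇-attained f []           = [] , ⊆-refl , refl
min⊇-attained f (inside ∷ A) =
  let W , A⊆W , eq = min⊇-attained (f ∘ (inside ∷_)) A in inside ∷ W , s⊆s A⊆W , eq
min⊇-attained f (outside ∷ A)
  with ⊓-sel (min⊇ (f ∘ (outside ∷_)) A) (min⊇ (f ∘ (inside ∷_)) A)
... | inj₁ e = let W , A⊆W , eq = min⊇-attained (f ∘ (outside ∷_)) A in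
               outside ∷ W , s⊆s A⊆W , trans eq (sym e)
... | inj₂ e = let W , A⊆W , eq = min⊇-attained (f ∘ (inside ∷_)) A in
               inside ∷ W , out⊆ A⊆W , trans eq (sym e)

IsMaximal : ∀ {m} → (Subset m → ℕ) → Subset m → Set
IsMaximal f S = ∀ W → S ⊆ W → f W ≤ f S → W ⊆ S

-- Pass to a strictly larger set of no larger value while there is one. A minimiser thus becomes a
-- maximal minimiser, as `maximal⇒closed` requires.
enlarge : ∀ {m} (f : Subset m → ℕ) S → ∃ λ W → S ⊆ W × f W ≤ f S × IsMaximal f W
enlarge {m} f S = go S (⊃-wellFounded S)
  where
  go : ∀ S → Acc _⊃_ S → ∃ λ W → S ⊆ W × f W ≤ f S × IsMaximal f W
  go S (acc rec) with anySubset? (λ W → (S ⊂? W) ×-dec (f W ≤? f S))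
  ... | yes (W , S⊂W , fW≤fS) =
    let V , W⊆V , fV≤fW , V-max = go W (rec S⊂W) in
    V , ⊆-trans (p⊂q⇒p⊆q S⊂W) W⊆V , ≤-trans fV≤fW fW≤fS , V-max
  ... | no none = S , ⊆-refl , ≤-refl , λ W S⊆W fW≤fS {x} x∈W →
    decidable-stable (x ∈? S) λ x∉S → none (W , ((S⊆W , x , x∈W , x∉S) , fW≤fS))

-- The scheme of every `arith` below: the hypotheses add up to `c ≤ d`, and `k` collects what
-- cancels, leaving two ring identities.
cancel-≤ : ∀ {a b c d} k → c ≤ d → a + k ≡ c → d ≡ b + k → a ≤ b
cancel-≤ {a} {b} k c≤d refl refl = +-cancelʳ-≤ k a b c≤d

-- Submodularity and flats.

module _ {m} (R : Matroid m) where

  submod-⊆ : ∀ {A B C D} → C ⊆ A → C ⊆ B → D ⊆ A ∪ B → rk R D + rk R C ≤ rk R A + rk R B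
  submod-⊆ {A} {B} {C} {D} C⊆A C⊆B D⊆ =
    ≤-trans (+-mono-≤ (rk-mono R D (A ∪ B) D⊆) (rk-mono R C (A ∩ B) (∩-glb C⊆A C⊆B)))
            (rk-submod R A B)

  IsFlat? : ∀ F → Dec (IsFlat R F)
  IsFlat? F = all? λ e → ¬? (e ∈? F) →-dec (rk R F <? rk R (F ∪ ⁅ e ⁆))

  -- An element of `H` outside `F` would raise the rank of `F` while staying inside `H`.
  flat-absorbs : ∀ {F H} → IsFlat R F → F ⊆ H → rk R H ≤ rk R F → H ⊆ F
  flat-absorbs {F} {H} flat F⊆H rH≤rF {e} e∈H = decidable-stable (e ∈? F) λ e∉F →
    <⇒≱ (flat e e∉F) (≤-trans (rk-mono R _ _ (∪-lub F⊆H (⁅⁆⊆ e∈H))) rH≤rF)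

  -- An element outside the meet misses `F` or `G`. By submodularity it raises the rank of the meet
  -- at least as much as that of the flat it misses.
  flat-∩ : ∀ {F G} → IsFlat R F → IsFlat R G → IsFlat R (F ∩ G)
  flat-∩ {F} {G} flatF flatG e e∉F∩G with e ∈? F
  ... | no e∉F = ≰⇒> λ r≤ → <⇒≱ (flatF e e∉F)
    (+-cancelʳ-≤ (rk R (F ∩ G)) _ _ (≤-trans
      (submod-⊆ (p∩q⊆p F G) (p⊆p∪q _) (∪-mono {A = F} ⊆-refl (q⊆p∪q (F ∩ G) ⁅ e ⁆)))
      (+-monoʳ-≤ (rk R F) r≤)))
  ... | yes e∈F = ≰⇒> λ r≤ → <⇒≱ (flatG e λ e∈G → e∉F∩G (x∈p∩q⁺ (e∈F , e∈G)))
    (+-cancelʳ-≤ (rk R (F ∩ G)) _ _ (≤-trans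
      (submod-⊆ (p∩q⊆q F G) (p⊆p∪q _) (∪-mono {A = G} ⊆-refl (q⊆p∪q (F ∩ G) ⁅ e ⁆)))
      (+-monoʳ-≤ (rk R G) r≤)))

does⇒ : ∀ {P : Set} (P? : Dec P) → does P? ≡ true → P
does⇒ (yes p) _ = p

-- Modular cuts of an OTE matroid.

module _ {n} (M : Matroid n) (ote : OTE M) where

  -- The cut contains `x`, so by OTE it is principal. Its generator lies in every member, hence in
  -- `x ∩ y`.
  cut-meet : (P : Subset n → Set) → (∀ F → Dec (P F)) → (∀ F → P F → IsFlat M F) →
    (∀ F F′ → P F → IsFlat M F′ → F ⊆ F′ → P F′) →
    (∀ F G → P F → P G → IsModularPair M F G → P (F ∩ G)) →
    ∀ {x y} → P x → P y → ∃ λ F → P F × F ⊆ x ∩ y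
  cut-meet P P? flats up meets {x} {y} Px Py with ote (does ∘ P?) record
    { only-flats = λ F p → flats F (does⇒ (P? F) p)
    ; up-closed  = λ F F′ p flat F⊆F′ → dec-true (P? F′) (up F F′ (does⇒ (P? F) p) flat F⊆F′)
    ; modular    = λ F G p q mod → dec-true (P? (F ∩ G)) (meets F G (does⇒ (P? F) p) (does⇒ (P? G) q) mod)
    }
  ... | inj₁ empty with () ← trans (sym (dec-true (P? x) Px)) (empty x)
  ... | inj₂ (F , flatF , principal) =
    F , does⇒ (P? F) (proj₂ (principal F) (flatF , ⊆-refl)) ,
    ∩-glb (proj₂ (proj₁ (principal x) (dec-true (P? x) Px)))
          (proj₂ (proj₁ (principal y) (dec-true (P? y) Py)))

  Full-absorbs : ∀ {F} → IsFlat M F → rank M ≤ rk M F → F ≡ Full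
  Full-absorbs flat r≤ = ⊆-antisym (⊆-max _) (flat-absorbs M flat (⊆-max _) r≤)

  -- Otherwise {H₁ , H₂ , Full} would be a non-principal modular cut.
  hyperplanes-modular : ∀ {H₁ H₂} → IsFlat M H₁ → IsFlat M H₂ →
    rank M ≡ suc (rk M H₁) → rank M ≡ suc (rk M H₂) →
    rk M H₁ + rk M H₂ ≤ rk M (H₁ ∪ H₂) + rk M (H₁ ∩ H₂)
  hyperplanes-modular {H₁} {H₂} flat₁ flat₂ hyp₁ hyp₂
    with rk M H₁ + rk M H₂ ≤? rk M (H₁ ∪ H₂) + rk M (H₁ ∩ H₂)
  ... | yes p = p
  ... | no ¬p = contradiction (conclude (cut-meet P P? flats up meets (inj₁ refl) (inj₂ (inj₁ refl)))) ¬p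
    where
    P : Subset n → Set
    P F = F ≡ H₁ ⊎ F ≡ H₂ ⊎ F ≡ Full

    P? : ∀ F → Dec (P F)
    P? F = ≡-dec Bool._≟_ F H₁ ⊎-dec ≡-dec Bool._≟_ F H₂ ⊎-dec ≡-dec Bool._≟_ F Full

    flats : ∀ F → P F → IsFlat M F
    flats _ (inj₁ refl)        = flat₁
    flats _ (inj₂ (inj₁ refl)) = flat₂
    flats _ (inj₂ (inj₂ refl)) = λ e e∉ → contradiction ∈⊤ e∉

    above : ∀ {H F} → IsFlat M H → rank M ≡ suc (rk M H) → IsFlat M F → H ⊆ F → F ≡ H ⊎ F ≡ Full
    above {H} {F} flatH hyp flatF H⊆F with rk M F ≤? rk M H
    ... | yes r≤ = inj₁ (⊆-antisym (flat-absorbs M flatH H⊆F r≤) H⊆F)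
    ... | no r≰  = inj₂ (Full-absorbs flatF (subst (_≤ rk M F) (sym hyp) (≰⇒> r≰)))

    up : ∀ F F′ → P F → IsFlat M F′ → F ⊆ F′ → P F′
    up _ F′ (inj₁ refl) flat F⊆F′ with above flat₁ hyp₁ flat F⊆F′
    ... | inj₁ eq = inj₁ eq
    ... | inj₂ eq = inj₂ (inj₂ eq)
    up _ F′ (inj₂ (inj₁ refl)) flat F⊆F′ = inj₂ (above flat₂ hyp₂ flat F⊆F′)
    up _ F′ (inj₂ (inj₂ refl)) flat F⊆F′ = inj₂ (inj₂ (⊆-antisym (⊆-max _) F⊆F′))

    meets : ∀ F G → P F → P G → IsModularPair M F G → P (F ∩ G)
    meets F _ p (inj₂ (inj₂ refl)) _ = subst P (sym (∩-identityʳ F)) p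
    meets _ G (inj₂ (inj₂ refl)) q _ = subst P (sym (∩-identityˡ G)) q
    meets _ _ (inj₁ refl) (inj₁ refl) _ = inj₁ (∩-idem H₁)
    meets _ _ (inj₂ (inj₁ refl)) (inj₂ (inj₁ refl)) _ = inj₂ (inj₁ (∩-idem H₂))
    meets _ _ (inj₁ refl) (inj₂ (inj₁ refl)) mod = contradiction (≤-reflexive mod) ¬p
    meets _ _ (inj₂ (inj₁ refl)) (inj₁ refl) mod = contradiction (≤-reflexive
      (trans (+-comm (rk M H₁) _) (trans mod (cong₂ (λ A B → rk M A + rk M B) (∪-comm H₂ H₁) (∩-comm H₂ H₁))))) ¬p

    same : rk M H₂ ≡ rk M H₁
    same = suc-injective (trans (sym hyp₂) hyp₁)

    rk-P : ∀ F → P F → rk M H₂ ≤ rk M F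
    rk-P _ (inj₁ refl)        = ≤-reflexive same
    rk-P _ (inj₂ (inj₁ refl)) = ≤-refl
    rk-P _ (inj₂ (inj₂ refl)) = rk-mono M H₂ Full (⊆-max H₂)

    conclude : (∃ λ F → P F × F ⊆ H₁ ∩ H₂) → rk M H₁ + rk M H₂ ≤ rk M (H₁ ∪ H₂) + rk M (H₁ ∩ H₂)
    -- The generator has at least the rank of a hyperplane, hence so has the meet: this is the
    -- inequality that was assumed to fail.
    conclude (F , PF , F⊆) = +-mono-≤ (rk-mono M _ _ (p⊆p∪q H₂)) (≤-trans (rk-P F PF) (rk-mono M _ _ F⊆))

  -- g - g₀ is the rank function of a quotient of M whose rank is at most one less than
  -- that of M; the flats whose rank drops form a modular cut.
  elementary-quotient : (g : Subset n → ℕ) (g₀ : ℕ) →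
    (∀ A B → g (A ∪ B) + g (A ∩ B) ≤ g A + g B) →
    (∀ {A B} → A ⊆ B → g B + rk M A ≤ g A + rk M B) →
    rank M + g₀ ≤ suc (g Full) →
    ∀ {x y} → IsFlat M x → IsFlat M y → g x < g₀ + rk M x → g y < g₀ + rk M y →
    g (x ∩ y) < g₀ + rk M (x ∩ y)
  elementary-quotient g g₀ submod quot corank {x} {y} flatx flaty dropx dropy =
    let F , (_ , dropF) , F⊆ = cut-meet P P? (λ _ → proj₁) (λ _ _ p flat F⊆ → flat , raise F⊆ (proj₂ p))
                                 meets (flatx , dropx) (flaty , dropy)
    in raise F⊆ dropF
    where
    P : Subset n → Set
    P F = IsFlat M F × g F < g₀ + rk M F

    P? : ∀ F → Dec (P F)
    P? F = IsFlat? M F ×-dec (g F <? g₀ + rk M F)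

    -- By `quot`, the drop `g₀ + rk M F - g F` never decreases as `F` grows.
    raise : ∀ {A B} → A ⊆ B → g A < g₀ + rk M A → g B < g₀ + rk M B
    raise {A} {B} A⊆B drop = arith (g A) (g B) (rk M A) (rk M B) (quot A⊆B) drop
      where
      arith : ∀ gA gB rA rB → gB + rA ≤ gA + rB → suc gA ≤ g₀ + rA → suc gB ≤ g₀ + rB
      arith gA gB rA rB p q = cancel-≤ (rA + gA) (+-mono-≤ p q) (lhs gA gB rA) (rhs g₀ gA rA rB)
        where
        lhs : ∀ gA gB rA → suc gB + (rA + gA) ≡ gB + rA + suc gA
        lhs = solve-∀
        rhs : ∀ g₀ gA rA rB → gA + rB + (g₀ + rA) ≡ g₀ + rB + (rA + gA)
        rhs = solve-∀

    meets : ∀ F G → P F → P G → IsModularPair M F G → P (F ∩ G)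
    -- For a modular pair the drops of join and meet add up to at least those of `F` and `G`, so to
    -- at least two. The drop of the join is at most that of `Full`, which is at most one by
    -- `corank`.
    meets F G (flatF , dropF) (flatG , dropG) mod = flat-∩ M flatF flatG ,
      arith (g F) (g G) (g (F ∪ G)) (g (F ∩ G)) (g Full) (rk M F) (rk M G) (rk M (F ∪ G)) (rk M (F ∩ G)) (rank M)
        (submod F G) (quot (⊆-max (F ∪ G))) dropF dropG (≤-reflexive mod) corank
      where
      arith : ∀ gF gG gU gI gE rF rG rU rI rE →
        gU + gI ≤ gF + gG → gE + rU ≤ gU + rE → suc gF ≤ g₀ + rF → suc gG ≤ g₀ + rG →
        rF + rG ≤ rU + rI → rE + g₀ ≤ suc gE → suc gI ≤ g₀ + rI
      arith gF gG gU gI gE rF rG rU rI rE p q r s t u = cancel-≤ (gU + gE + rU + gF + gG + rF + rG + rE + g₀ + 1)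
        (+-mono-≤ p (+-mono-≤ q (+-mono-≤ r (+-mono-≤ s (+-mono-≤ t u)))))
        (lhs g₀ gF gG gU gI gE rF rG rU rI rE) (rhs g₀ gF gG gU gI gE rF rG rU rI rE)
        where
        lhs : ∀ g₀ gF gG gU gI gE rF rG rU rI rE →
          suc gI + (gU + gE + rU + gF + gG + rF + rG + rE + g₀ + 1) ≡
          gU + gI + (gE + rU + (suc gF + (suc gG + (rF + rG + (rE + g₀)))))
        lhs = solve-∀
        rhs : ∀ g₀ gF gG gU gI gE rF rG rU rI rE →
          gF + gG + (gU + rE + (g₀ + rF + (g₀ + rG + (rU + rI + suc gE)))) ≡
          g₀ + rI + (gU + gE + rU + gF + gG + rF + rG + rE + g₀ + 1)
        rhs = solve-∀

-- Closed sets and contractions in one extension.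

module Extension {n k} (M : Matroid n) (R : Matroid (n + k)) (ext : IsExtension {n} {k} M R) where
  open Trace n k

  -- Only elements of `E` are tested: new elements may be spanned by `S` without belonging to it.
  Closed : Subset (n + k) → Set
  Closed S = ∀ F → rk R (S ∪ ι F) ≤ rk R S → F ⊆ τ S

  rk-τ≤ : ∀ S → rk M (τ S) ≤ rk R S
  rk-τ≤ S = subst (_≤ rk R S) (ext (τ S)) (rk-mono R _ _ (ιτ⊆ S))

  -- Submodularity of `S` and `ι (τ S ∪ F)`: adding `F` costs no more over `S` than over its trace.
  rk-∪ι : ∀ S F → rk R (S ∪ ι F) + rk M (τ S) ≤ rk R S + rk M (τ S ∪ F)
  rk-∪ι S F = subst₂ (λ a b → rk R (S ∪ ι F) + a ≤ rk R S + b) (ext (τ S)) (ext (τ S ∪ F))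
    (submod-⊆ R (ιτ⊆ S) (ι-mono (p⊆p∪q F)) (∪-mono {A = S} ⊆-refl (ι-mono (q⊆p∪q (τ S) F))))

  closed⇒flat : ∀ {S} → Closed S → IsFlat M (τ S)
  closed⇒flat {S} closed e e∉ = ≰⇒> λ r≤ → e∉ (closed ⁅ e ⁆
    (+-cancelʳ-≤ (rk M (τ S)) _ _ (≤-trans (rk-∪ι S ⁅ e ⁆) (+-monoʳ-≤ (rk R S) r≤))) (x∈⁅x⁆ e))

  -- Whatever `S ∩ T` spans is spanned by both `S` and `T`.
  closed-∩ : ∀ {S T} → Closed S → Closed T → Closed (S ∩ T)
  closed-∩ {S} {T} closedS closedT F r≤ = subst (F ⊆_) (sym (τ-∩ S T))
    (∩-glb (closedS F (absorb (p∩q⊆p S T))) (closedT F (absorb (p∩q⊆q S T))))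
    where
    absorb : ∀ {U} → S ∩ T ⊆ U → rk R (U ∪ ι F) ≤ rk R U
    absorb {U} ⊆U = +-cancelʳ-≤ (rk R (S ∩ T)) _ _ (≤-trans
      (submod-⊆ R ⊆U (p⊆p∪q (ι F)) (∪-mono {A = U} ⊆-refl (q⊆p∪q (S ∩ T) (ι F))))
      (+-monoʳ-≤ (rk R U) r≤))

  module Contraction (Z : Subset (n + k)) where

    -- `g F - rk R Z` is the rank of `F` after contracting `Z`; keeping the constant avoids
    -- subtraction.
    g : Subset n → ℕ
    g F = rk R (Z ∪ ι F)

    g-lower : ∀ F → rk R Z ≤ g F
    g-lower F = rk-mono R _ _ (p⊆p∪q (ι F))

    g-mono : ∀ {A B} → A ⊆ B → g A ≤ g B
    g-mono A⊆B = rk-mono R _ _ (∪-mono {A = Z} ⊆-refl (ι-mono A⊆B))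

    g-submod : ∀ A B → g (A ∪ B) + g (A ∩ B) ≤ g A + g B
    g-submod A B = submod-⊆ R
      (∪-mono {A = Z} ⊆-refl (ι-mono (p∩q⊆p A B)))
      (∪-mono {A = Z} ⊆-refl (ι-mono (p∩q⊆q A B)))
      (∪-lub (⊆-trans (p⊆p∪q (ι A)) (p⊆p∪q (Z ∪ ι B)))
             (⊆-trans (ι-∪⊆ A B) (∪-mono (q⊆p∪q Z (ι A)) (q⊆p∪q Z (ι B)))))

    g-quotient : ∀ {A B} → A ⊆ B → g B + rk M A ≤ g A + rk M B
    g-quotient {A} {B} A⊆B = subst₂ (λ a b → g B + a ≤ g A + b) (ext A) (ext B)
      (submod-⊆ R (q⊆p∪q Z (ι A)) (ι-mono A⊆B) (∪-mono (p⊆p∪q (ι A)) ⊆-refl))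

  -- Let Z = X ∩ Y.  If X, Y is a modular pair of R, then x and y both meet the span of Z
  -- (possibly outside the ground set), so by OTE the rank of M drops by at least two
  -- when Z is contracted.
  module Disjoint (ote : OTE M) (rank4 : rank M ≡ 4) (X Y : Subset (n + k))
    (closedX : Closed X) (closedY : Closed Y)
    (mod : rk R X + rk R Y ≤ rk R (X ∪ Y) + rk R (X ∩ Y))
    (line : rk M (τ X) ≡ 2) (nonpoint : 0 < rk M (τ Y))
    (defect : rk M (τ X ∪ τ Y) ≡ suc (rk M (τ Y))) (disjoint : rk M (τ X ∩ τ Y) ≡ 0)
    where
    Z : Subset (n + k)
    Z = X ∩ Y
    x y : Subset n
    x = τ X
    y = τ Y
    open Contraction Z

    -- A modular pair stays modular when its members are shrunk to sets above the meet `Z`. First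
    -- `Y` shrinks to `Z ∪ ι y`, giving the union `X ∪ (Z ∪ ι y)`, then `X` to `Z ∪ ι x`.
    g-modular : g x + g y ≤ g (x ∪ y) + rk R Z
    g-modular = arith (rk R X) (rk R Y) (g x) (g y) (g (x ∪ y)) (rk R Z) (rk R (X ∪ Y)) (rk R (X ∪ (Z ∪ ι y)))
      (submod-⊆ R (∪-lub (p∩q⊆p X Y) (ιτ⊆ X)) (∪-mono {A = Z} ⊆-refl (ι-mono (p⊆p∪q y)))
        (∪-mono {A = X} ⊆-refl (∪-mono {A = Z} ⊆-refl (ι-mono (q⊆p∪q x y)))))
      (submod-⊆ R (q⊆p∪q X (Z ∪ ι y)) (∪-lub (p∩q⊆q X Y) (ιτ⊆ Y))
        (∪-mono (p⊆p∪q (Z ∪ ι y)) ⊆-refl))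
      mod
      where
      arith : ∀ X Y gx gy gu z U T → T + gx ≤ X + gu → U + gy ≤ T + Y → X + Y ≤ U + z → gx + gy ≤ gu + z
      arith X Y gx gy gu z U T p q r = cancel-≤ (T + U + X + Y) (+-mono-≤ p (+-mono-≤ q r))
        (lhs X Y gx gy U T) (rhs X Y gu z U T)
        where
        lhs : ∀ X Y gx gy U T → gx + gy + (T + U + X + Y) ≡ T + gx + (U + gy + (X + Y))
        lhs = solve-∀
        rhs : ∀ X Y gu z U T → X + gu + (T + Y + (U + z)) ≡ gu + z + (T + U + X + Y)
        rhs = solve-∀

    -- `Z` is closed and its trace has rank zero, so it spans no set of positive rank.
    not-in-Z : ∀ {F} → 0 < rk M F → rk R Z < g F
    not-in-Z {F} 0<rF = ≰⇒> λ g≤ → <⇒≱ 0<rF (subst (rk M F ≤_) disjoint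
      (rk-mono M _ _ (subst (F ⊆_) (τ-∩ X Y) (closed-∩ closedX closedY F g≤))))

    -- By modularity `x` gains no more over `Z` than over `Z ∪ ι y`, and there at most one, by
    -- `defect`.
    gx≤ : g x ≤ suc (rk R Z)
    gx≤ = arith (g x) (g y) (g (x ∪ y)) (rk R Z) (rk M y) g-modular
      (subst (λ u → g (x ∪ y) + rk M y ≤ g y + u) defect (g-quotient (q⊆p∪q x y)))
      where
      arith : ∀ gx gy gu z r → gx + gy ≤ gu + z → gu + r ≤ gy + suc r → gx ≤ suc z
      arith gx gy gu z r p q = cancel-≤ (gy + gu + r) (+-mono-≤ p q) (lhs gx gy gu r) (rhs gy gu z r)
        where
        lhs : ∀ gx gy gu r → gx + (gy + gu + r) ≡ gx + gy + (gu + r)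
        lhs = solve-∀
        rhs : ∀ gy gu z r → gu + z + (gy + suc r) ≡ suc z + (gy + gu + r)
        rhs = solve-∀

    gy<g∪ : g y < g (x ∪ y)
    gy<g∪ = +-cancelʳ-≤ (rk R Z) _ _ (≤-trans
      (≤-reflexive (trans (sym (+-suc (g y) (rk R Z))) (+-comm (g y) _)))
      (≤-trans (+-monoˡ-≤ (g y) (not-in-Z (subst (0 <_) (sym line) (s≤s z≤n)))) g-modular))

    -- Over the line `x`, the flat `y` gains only `rk M y - 1`. With `gy<g∪` it follows that the
    -- rank of `y` drops.
    g∪≤ : g (x ∪ y) ≤ rk R Z + rk M y
    g∪≤ = arith (g x) (g (x ∪ y)) (rk R Z) (rk M y) gx≤
      (subst₂ (λ a u → g (x ∪ y) + a ≤ g x + u) line defect (g-quotient (p⊆p∪q y)))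
      where
      arith : ∀ gx gu z r → gx ≤ suc z → gu + 2 ≤ gx + suc r → gu ≤ z + r
      arith gx gu z r p q = cancel-≤ (gx + 2) (+-mono-≤ p q) (lhs gx gu) (rhs gx z r)
        where
        lhs : ∀ gx gu → gu + (gx + 2) ≡ gx + (gu + 2)
        lhs = solve-∀
        rhs : ∀ gx z r → suc z + (gx + suc r) ≡ z + r + (gx + 2)
        rhs = solve-∀

    -- A larger value would mean that the rank 4 drops by at most one. By `elementary-quotient` the
    -- rank of `x ∩ y` would then drop too, but it is zero already.
    gFull≤ : g Full ≤ 2 + rk R Z
    gFull≤ = ≮⇒≥ λ big → <⇒≱
      (subst (λ c → g (x ∩ y) < rk R Z + c) disjoint
        (elementary-quotient M ote g (rk R Z) g-submod g-quotient
          (subst (λ r → r + rk R Z ≤ suc (g Full)) (sym rank4) (s≤s big))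
          (closed⇒flat closedX) (closed⇒flat closedY)
          (subst (λ a → g x < rk R Z + a) (sym line) (≤-trans (s≤s gx≤) (≤-reflexive (+-comm 2 (rk R Z)))))
          (≤-trans gy<g∪ g∪≤)))
      (subst (_≤ g (x ∩ y)) (sym (+-identityʳ (rk R Z))) (g-lower (x ∩ y)))

    gy≤ : g y ≤ suc (rk R Z)
    gy≤ = ≤-pred (≤-trans gy<g∪ (≤-trans (g-mono (⊆-max (x ∪ y))) gFull≤))

    -- The ranks of `Z`, `Z ∪ ι y` and `Z ∪ ι (x ∪ y)` increase strictly, so the last set reaches
    -- the bound of `gFull≤` and spans `E`.
    Full-spanned : rk R ((X ∪ Y) ∪ ι Full) ≤ rk R (X ∪ Y)
    Full-spanned = +-cancelʳ-≤ (g (x ∪ y)) _ _ (≤-trans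
      (submod-⊆ R
        (∪-lub (⊆-trans (p∩q⊆p X Y) (p⊆p∪q Y)) (⊆-trans (ι-∪⊆ x y) (∪-mono (ιτ⊆ X) (ιτ⊆ Y))))
        (∪-mono {A = Z} ⊆-refl (ι-mono (⊆-max (x ∪ y))))
        (∪-mono {A = X ∪ Y} ⊆-refl (q⊆p∪q Z (ι Full))))
      (+-monoʳ-≤ (rk R (X ∪ Y)) (≤-trans gFull≤ (≤-trans (s≤s (not-in-Z nonpoint)) gy<g∪))))

-- Arithmetic of ranks in rank 4.

-- a, b, u, c are the ranks of two incomparable flats, their join and their meet in rank 4.
nonmodular-ranks : ∀ {a b u c} → c < a → c < b → a < u → b < u → u ≤ 4 → u + c < a + b →
  (a ≡ 3 × b ≡ 3) ⊎ (a ≡ 2 × c ≡ 0 × u ≡ suc b × (b ≡ 2 ⊎ b ≡ 3)) ⊎ (b ≡ 2 × c ≡ 0 × u ≡ suc a × a ≡ 3)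
nonmodular-ranks {1} {b} {u} {c} _ _ _ b<u _ lt =
  contradiction (≤-trans b<u (≤-trans (m≤m+n u c) (≤-pred lt))) (<-irrefl refl)
nonmodular-ranks {a} {1} {u} {c} _ _ a<u _ _ lt =
  contradiction (≤-trans a<u (≤-trans (m≤m+n u c) (≤-pred (subst (u + c <_) (+-comm a 1) lt)))) (<-irrefl refl)
nonmodular-ranks {3} {3} _ _ _ _ _ _ = inj₁ (refl , refl)
nonmodular-ranks {2} {2} {3} {0} _ _ _ _ _ _ = inj₂ (inj₁ (refl , refl , refl , inj₁ refl))
nonmodular-ranks {2} {3} {4} {0} _ _ _ _ _ _ = inj₂ (inj₁ (refl , refl , refl , inj₂ refl))
nonmodular-ranks {3} {2} {4} {0} _ _ _ _ _ _ = inj₂ (inj₂ (refl , refl , refl , refl))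
nonmodular-ranks {2} {2} {3} {suc c} _ _ _ _ _ (s≤s (s≤s (s≤s (s≤s ()))))
nonmodular-ranks {2} {3} {4} {suc c} _ _ _ _ _ (s≤s (s≤s (s≤s (s≤s (s≤s ())))))
nonmodular-ranks {3} {2} {4} {suc c} _ _ _ _ _ (s≤s (s≤s (s≤s (s≤s (s≤s ())))))
nonmodular-ranks {2} {2} {suc (suc (suc (suc u)))} _ _ _ _ _ (s≤s (s≤s (s≤s (s≤s ()))))
nonmodular-ranks {2} {3} {suc (suc (suc (suc (suc u))))} _ _ _ _ (s≤s (s≤s (s≤s (s≤s ())))) _
nonmodular-ranks {3} {2} {suc (suc (suc (suc (suc u))))} _ _ _ _ (s≤s (s≤s (s≤s (s≤s ())))) _
nonmodular-ranks {2} {2} {2} _ _ (s≤s (s≤s ())) _ _ _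
nonmodular-ranks {2} {2} {1} _ _ (s≤s ()) _ _ _
nonmodular-ranks {2} {3} {3} _ _ _ (s≤s (s≤s (s≤s ()))) _ _
nonmodular-ranks {2} {3} {2} _ _ _ (s≤s (s≤s ())) _ _
nonmodular-ranks {2} {3} {1} _ _ _ (s≤s ()) _ _
nonmodular-ranks {3} {2} {3} _ _ (s≤s (s≤s (s≤s ()))) _ _ _
nonmodular-ranks {3} {2} {2} _ _ (s≤s (s≤s ())) _ _ _
nonmodular-ranks {3} {2} {1} _ _ (s≤s ()) _ _ _
nonmodular-ranks {suc (suc (suc (suc a)))} {b} {u} _ _ a<u _ u≤4 _ with ≤-trans a<u u≤4
... | s≤s (s≤s (s≤s (s≤s ())))
nonmodular-ranks {a} {suc (suc (suc (suc b)))} {u} _ _ _ b<u u≤4 _ with ≤-trans b<u u≤4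
... | s≤s (s≤s (s≤s (s≤s ())))

exchange-lhs : ∀ s t ηV ηW rV rW r →
  ηV + ηW + (s + t + (rV + rW) + r) ≡
  s + (ηV + rV + (ηW + rW)) + (t + r)
exchange-lhs = solve-∀
exchange-rhs : ∀ s t ηX ηY r rX rY →
  t + (ηX + rX + (ηY + rY)) + (s + r) ≡
  ηX + ηY + (s + t + r + (rX + rY))
exchange-rhs = solve-∀

exchange-arith : ∀ s t ηV ηW ηX ηY rV rW rX rY →
  s + (ηV + rV + (ηW + rW)) ≤ t + (ηX + rX + (ηY + rY)) →
  t + (rX + rY) ≤ s + (rV + rW) → ηV + ηW ≤ ηX + ηY
exchange-arith s t ηV ηW ηX ηY rV rW rX rY p q =
  cancel-≤ (s + t + (rV + rW) + (rX + rY)) (+-mono-≤ p q)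
    (exchange-lhs s t ηV ηW rV rW (rX + rY)) (exchange-rhs s t ηX ηY (rV + rW) rX rY)

-- The amalgam of two extensions on one ground set.

module Amalgam {n k} (M : Matroid n) (ote : OTE M) (rank4 : rank M ≡ 4) (R₁ R₂ : Matroid (n + k))
  (ext₁ : IsExtension {n} {k} M R₁) (ext₂ : IsExtension {n} {k} M R₂)
  where
  open Trace n k
  module E₁ = Extension M R₁ ext₁
  module E₂ = Extension M R₂ ext₂

  r : Subset (n + k) → ℕ
  r S = rk M (τ S)

  σ : Subset (n + k) → ℕ
  σ S = rk R₁ S + rk R₂ S

  η : Subset (n + k) → ℕ
  η S = σ S ∸ r S

  -- The truncated subtraction in `η` is exact, since a trace has no larger rank than its set.
  η+r : ∀ S → η S + r S ≡ σ S
  η+r S = m∸n+n≡m (≤-trans (E₁.rk-τ≤ S) (m≤m+n (rk R₁ S) (rk R₂ S)))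

  Closed : Subset (n + k) → Set
  Closed S = E₁.Closed S × E₂.Closed S

  η-absorb : ∀ {S F} → σ (S ∪ ι F) + r S ≤ σ S + rk M (τ S ∪ F) → η (S ∪ ι F) ≤ η S
  η-absorb {S} {F} p = arith (η (S ∪ ι F)) (r (S ∪ ι F)) (σ (S ∪ ι F)) (η S) (r S) (σ S)
    (≤-reflexive (η+r (S ∪ ι F))) (≤-reflexive (sym (η+r S)))
    (subst (λ A → σ (S ∪ ι F) + r S ≤ σ S + rk M A) (sym (trans (τ-∪ S (ι F)) (cong (τ S ∪_) (τ-ι F)))) p)
    where
    arith : ∀ η′ r′ σ′ η r σ → η′ + r′ ≤ σ′ → σ ≤ η + r → σ′ + r ≤ σ + r′ → η′ ≤ η
    arith η′ r′ σ′ η r σ p q s = cancel-≤ (r′ + σ′ + r + σ) (+-mono-≤ p (+-mono-≤ q s))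
      (lhs η′ r′ σ′ r σ) (rhs r′ σ′ η r σ)
      where
      lhs : ∀ η′ r′ σ′ r σ → η′ + (r′ + σ′ + r + σ) ≡ η′ + r′ + (σ + (σ′ + r))
      lhs = solve-∀
      rhs : ∀ r′ σ′ η r σ → σ′ + (η + r + (σ + r′)) ≡ η + (r′ + σ′ + r + σ)
      rhs = solve-∀

  -- A set `F` spanned in one extension adds nothing there, and in the other at most what `r` gains.
  -- So adding it does not raise `η`, and maximality puts it inside `S`.
  maximal⇒closed : ∀ {S} → IsMaximal η S → Closed S
  maximal⇒closed {S} max =
    (λ F r≤ → absorbed F (≤-trans (≤-reflexive (+-assoc (rk R₁ (S ∪ ι F)) _ _))
      (≤-trans (+-mono-≤ r≤ (E₂.rk-∪ι S F)) (≤-reflexive (sym (+-assoc (rk R₁ S) _ _)))))) ,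
    (λ F r≤ → absorbed F (subst₂ _≤_
      (swap (rk R₁ (S ∪ ι F)) (rk R₂ (S ∪ ι F)) (r S)) (swap (rk R₁ S) (rk R₂ S) (rk M (τ S ∪ F)))
      (+-mono-≤ (E₁.rk-∪ι S F) r≤)))
    where
    absorbed : ∀ F → σ (S ∪ ι F) + r S ≤ σ S + rk M (τ S ∪ F) → F ⊆ τ S
    absorbed F p = ι⊆⇒⊆τ (⊆-trans (q⊆p∪q S (ι F)) (max (S ∪ ι F) (p⊆p∪q (ι F)) (η-absorb {S} {F} p)))
    swap : ∀ a b c → a + c + b ≡ a + b + c
    swap = solve-∀

  Exchange : Subset (n + k) → Subset (n + k) → Set
  Exchange X Y = ∃ λ V → ∃ λ W → X ∩ Y ⊆ V × X ∪ Y ⊆ W × η V + η W ≤ η X + η Y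

  exchange-sym : ∀ {X Y} → Exchange Y X → Exchange X Y
  exchange-sym {X} {Y} (V , W , ⊆V , ⊆W , p) =
    V , W , subst (_⊆ V) (∩-comm Y X) ⊆V , subst (_⊆ W) (∪-comm Y X) ⊆W ,
    subst (η V + η W ≤_) (+-comm (η Y) (η X)) p

  -- Rᵢ(V) + Rᵢ(W) may exceed Rᵢ(X) + Rᵢ(Y) by at most the integer tᵢ - sᵢ.
  exchange : ∀ {X Y} V W → X ∩ Y ⊆ V → X ∪ Y ⊆ W → ∀ s₁ t₁ s₂ t₂ →
    s₁ + (rk R₁ V + rk R₁ W) ≤ t₁ + (rk R₁ X + rk R₁ Y) →
    s₂ + (rk R₂ V + rk R₂ W) ≤ t₂ + (rk R₂ X + rk R₂ Y) →
    t₁ + t₂ + (r X + r Y) ≤ s₁ + s₂ + (r V + r W) →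
    Exchange X Y
  exchange {X} {Y} V W ⊆V ⊆W s₁ t₁ s₂ t₂ p₁ p₂ q = V , W , ⊆V , ⊆W ,
    exchange-arith (s₁ + s₂) (t₁ + t₂) (η V) (η W) (η X) (η Y) (r V) (r W) (r X) (r Y) total q
    where
    shuffle : ∀ s₁ s₂ a b c d → s₁ + s₂ + ((a + c) + (b + d)) ≡ (s₁ + (a + b)) + (s₂ + (c + d))
    shuffle = solve-∀
    total : s₁ + s₂ + (η V + r V + (η W + r W)) ≤ t₁ + t₂ + (η X + r X + (η Y + r Y))
    total = subst₂ _≤_
      (trans (sym (shuffle s₁ s₂ (rk R₁ V) (rk R₁ W) (rk R₂ V) (rk R₂ W)))
             (cong (s₁ + s₂ +_) (sym (cong₂ _+_ (η+r V) (η+r W)))))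
      (trans (sym (shuffle t₁ t₂ (rk R₁ X) (rk R₁ Y) (rk R₂ X) (rk R₂ Y)))
             (cong (t₁ + t₂ +_) (sym (cong₂ _+_ (η+r X) (η+r Y)))))
      (+-mono-≤ p₁ p₂)

  submod-∩∪ : ∀ (R : Matroid (n + k)) X Y → rk R (X ∩ Y) + rk R (X ∪ Y) ≤ rk R X + rk R Y
  submod-∩∪ R X Y = ≤-trans (≤-reflexive (+-comm (rk R (X ∩ Y)) _)) (rk-submod R X Y)

  r-∩∪ : ∀ X Y → r (X ∩ Y) + r (X ∪ Y) ≡ rk M (τ X ∪ τ Y) + rk M (τ X ∩ τ Y)
  r-∩∪ X Y = trans (+-comm (r (X ∩ Y)) _) (cong₂ (λ A B → rk M A + rk M B) (τ-∪ X Y) (τ-∩ X Y))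

  -- `σ` is submodular, and the subtracted `r` satisfies the reverse inequality on this pair.
  exchange-modular : ∀ X Y → r X + r Y ≤ rk M (τ X ∪ τ Y) + rk M (τ X ∩ τ Y) → Exchange X Y
  exchange-modular X Y p = exchange (X ∩ Y) (X ∪ Y) ⊆-refl ⊆-refl 0 0 0 0
    (submod-∩∪ R₁ X Y) (submod-∩∪ R₂ X Y) (subst (r X + r Y ≤_) (sym (r-∩∪ X Y)) p)

  exchange-line : ∀ X Y → Closed X → Closed Y → r X ≡ 2 → rk M (τ X ∩ τ Y) ≡ 0 →
    rk M (τ X ∪ τ Y) ≡ suc (r Y) → r Y ≡ 2 ⊎ r Y ≡ 3 → Exchange X Y
  exchange-line X Y (closedX₁ , closedX₂) (closedY₁ , closedY₂) line disjoint defect ry =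
    cases (rk R₁ X + rk R₁ Y ≤? rk R₁ (X ∪ Y) + rk R₁ (X ∩ Y))
          (rk R₂ X + rk R₂ Y ≤? rk R₂ (X ∪ Y) + rk R₂ (X ∩ Y)) ry
    where
    nonpoint : 0 < r Y
    nonpoint = [ (λ eq → subst (0 <_) (sym eq) (s≤s z≤n)) , (λ eq → subst (0 <_) (sym eq) (s≤s z≤n)) ]′ ry

    r-∩∪-eq : r (X ∩ Y) + r (X ∪ Y) ≡ suc (r Y)
    r-∩∪-eq = trans (r-∩∪ X Y) (trans (cong₂ _+_ defect disjoint) (+-identityʳ _))

    defect-one : r X + r Y ≤ 1 + (r (X ∩ Y) + r (X ∪ Y))
    defect-one = ≤-reflexive (trans (cong (_+ r Y) line) (cong suc (sym r-∩∪-eq)))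

    slack : ∀ (R : Matroid (n + k)) → ¬ rk R X + rk R Y ≤ rk R (X ∪ Y) + rk R (X ∩ Y) →
      1 + (rk R (X ∩ Y) + rk R (X ∪ Y)) ≤ rk R X + rk R Y
    slack R r≰ = subst (λ a → suc a ≤ rk R X + rk R Y) (+-comm (rk R (X ∪ Y)) _) (≰⇒> r≰)

    cases : Dec (rk R₁ X + rk R₁ Y ≤ rk R₁ (X ∪ Y) + rk R₁ (X ∩ Y)) →
            Dec (rk R₂ X + rk R₂ Y ≤ rk R₂ (X ∪ Y) + rk R₂ (X ∩ Y)) →
            r Y ≡ 2 ⊎ r Y ≡ 3 → Exchange X Y
    -- Strictness in one extension pays for the defect of one.
    cases (no r≰) _ _ = exchange (X ∩ Y) (X ∪ Y) ⊆-refl ⊆-refl 1 0 0 0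
      (slack R₁ r≰) (submod-∩∪ R₂ X Y) defect-one
    cases (yes _) (no r≰) _ = exchange (X ∩ Y) (X ∪ Y) ⊆-refl ⊆-refl 0 0 1 0
      (submod-∩∪ R₁ X Y) (slack R₂ r≰) defect-one
    -- Adding `E` to the union is free in both extensions, and the trace of rank 4 alone makes up
    -- for `2 + 2`.
    cases (yes mod₁) (yes mod₂) (inj₁ r≡2) = exchange (X ∩ Y) ((X ∪ Y) ∪ ι Full) ⊆-refl (p⊆p∪q (ι Full)) 0 0 0 0
        (≤-trans (+-monoʳ-≤ (rk R₁ (X ∩ Y)) D₁.Full-spanned) (submod-∩∪ R₁ X Y))
        (≤-trans (+-monoʳ-≤ (rk R₂ (X ∩ Y)) D₂.Full-spanned) (submod-∩∪ R₂ X Y))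
        (≤-trans (≤-reflexive (cong₂ _+_ line r≡2)) (≤-trans
          (subst (_≤ r ((X ∪ Y) ∪ ι Full)) rank4 (rk-mono M _ _ (ι⊆⇒⊆τ (q⊆p∪q (X ∪ Y) (ι Full)))))
          (m≤n+m _ (r (X ∩ Y)))))
      where
      module D₁ = E₁.Disjoint ote rank4 X Y closedX₁ closedY₁ mod₁ line nonpoint defect disjoint
      module D₂ = E₂.Disjoint ote rank4 X Y closedX₂ closedY₂ mod₂ line nonpoint defect disjoint
    -- Adding `y` to the meet costs at most one in each extension, by `gy≤`. The traces then give
    -- `3 + 4`, which covers `2 + 3` and both units.
    cases (yes mod₁) (yes mod₂) (inj₂ r≡3) = exchange ((X ∩ Y) ∪ ι (τ Y)) (X ∪ Y) (p⊆p∪q (ι (τ Y))) ⊆-refl 0 1 0 1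
        (≤-trans (+-monoˡ-≤ (rk R₁ (X ∪ Y)) D₁.gy≤) (s≤s (submod-∩∪ R₁ X Y)))
        (≤-trans (+-monoˡ-≤ (rk R₂ (X ∪ Y)) D₂.gy≤) (s≤s (submod-∩∪ R₂ X Y)))
        (≤-trans (≤-reflexive (cong₂ (λ a b → 2 + (a + b)) line r≡3)) (+-mono-≤
          (subst (_≤ r ((X ∩ Y) ∪ ι (τ Y))) r≡3 (rk-mono M _ _ (ι⊆⇒⊆τ (q⊆p∪q (X ∩ Y) (ι (τ Y))))))
          (≤-reflexive (sym (trans (cong (rk M) (τ-∪ X Y)) (trans defect (cong suc r≡3)))))))
      where
      module D₁ = E₁.Disjoint ote rank4 X Y closedX₁ closedY₁ mod₁ line nonpoint defect disjoint
      module D₂ = E₂.Disjoint ote rank4 X Y closedX₂ closedY₂ mod₂ line nonpoint defect disjoint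

  exchange-closed : ∀ X Y → Closed X → Closed Y → Exchange X Y
  exchange-closed X Y closedX closedY
    with r X + r Y ≤? rk M (τ X ∪ τ Y) + rk M (τ X ∩ τ Y)
  ... | yes mod = exchange-modular X Y mod
  -- If one of the strict inequalities failed, one flat would contain the other, and comparable
  -- flats form a modular pair.
  ... | no nonmod = cases (nonmodular-ranks
      (≰⇒> λ r≤ → nonmod (comparable (⊆-trans (flat-absorbs M (flat-∩ M flatX flatY) (p∩q⊆p x y) r≤) (p∩q⊆q x y))))
      (≰⇒> λ r≤ → nonmod (comparable′ (⊆-trans (flat-absorbs M (flat-∩ M flatX flatY) (p∩q⊆q x y) r≤) (p∩q⊆p x y))))
      (≰⇒> λ r≤ → nonmod (comparable′ (⊆-trans (q⊆p∪q x y) (flat-absorbs M flatX (p⊆p∪q y) r≤))))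
      (≰⇒> λ r≤ → nonmod (comparable (⊆-trans (p⊆p∪q y) (flat-absorbs M flatY (q⊆p∪q x y) r≤))))
      (subst (rk M (x ∪ y) ≤_) rank4 (rk-mono M _ _ (⊆-max _)))
      (≰⇒> nonmod))
    where
    x y : Subset n
    x = τ X
    y = τ Y

    flatX : IsFlat M x
    flatX = E₁.closed⇒flat (proj₁ closedX)

    flatY : IsFlat M y
    flatY = E₁.closed⇒flat (proj₁ closedY)

    comparable : x ⊆ y → r X + r Y ≤ rk M (x ∪ y) + rk M (x ∩ y)
    comparable x⊆y = subst (_≤ rk M (x ∪ y) + rk M (x ∩ y)) (+-comm (r Y) (r X))
      (+-mono-≤ (rk-mono M _ _ (q⊆p∪q x y)) (rk-mono M _ _ (∩-glb ⊆-refl x⊆y)))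

    comparable′ : y ⊆ x → r X + r Y ≤ rk M (x ∪ y) + rk M (x ∩ y)
    comparable′ y⊆x = +-mono-≤ (rk-mono M _ _ (p⊆p∪q y)) (rk-mono M _ _ (∩-glb y⊆x ⊆-refl))

    cases : (r X ≡ 3 × r Y ≡ 3) ⊎
      (r X ≡ 2 × rk M (x ∩ y) ≡ 0 × rk M (x ∪ y) ≡ suc (r Y) × (r Y ≡ 2 ⊎ r Y ≡ 3)) ⊎
      (r Y ≡ 2 × rk M (x ∩ y) ≡ 0 × rk M (x ∪ y) ≡ suc (r X) × r X ≡ 3) → Exchange X Y
    cases (inj₁ (rx , ry)) = exchange-modular X Y (hyperplanes-modular M ote flatX flatY
      (trans rank4 (cong suc (sym rx))) (trans rank4 (cong suc (sym ry))))
    cases (inj₂ (inj₁ (rx , c , u , ry))) = exchange-line X Y closedX closedY rx c u ry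
    cases (inj₂ (inj₂ (ry , c , u , rx))) = exchange-sym {X} {Y} (exchange-line Y X closedY closedX ry
      (trans (cong (rk M) (∩-comm y x)) c) (trans (cong (rk M) (∪-comm y x)) u) (inj₂ rx))

  closed-minimizer : ∀ A → ∃ λ X → A ⊆ X × η X ≤ min⊇ η A × Closed X
  closed-minimizer A =
    let W , A⊆W , eq = min⊇-attained η A
        X , W⊆X , ηX≤ , max = enlarge η W
    in X , ⊆-trans A⊆W W⊆X , ≤-trans ηX≤ (≤-reflexive eq) , maximal⇒closed max

  ζ-submod : ∀ A B → min⊇ η (A ∪ B) + min⊇ η (A ∩ B) ≤ min⊇ η A + min⊇ η B
  ζ-submod A B =
    let X , A⊆X , ηX≤ , closedX = closed-minimizer A
        Y , B⊆Y , ηY≤ , closedY = closed-minimizer B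
        V , W , ∩⊆V , ∪⊆W , p = exchange-closed X Y closedX closedY
    in begin
      min⊇ η (A ∪ B) + min⊇ η (A ∩ B)
        ≤⟨ +-mono-≤ (min⊇-lower η (⊆-trans (∪-mono A⊆X B⊆Y) ∪⊆W)) (min⊇-lower η (⊆-trans (∩-mono A⊆X B⊆Y) ∩⊆V)) ⟩
      η W + η V ≡⟨ +-comm (η W) (η V) ⟩
      η V + η W ≤⟨ p ⟩
      η X + η Y ≤⟨ +-mono-≤ ηX≤ ηY≤ ⟩
      min⊇ η A + min⊇ η B ∎
    where open ≤-Reasoning

  -- The bound says `η S ≤ ∣ S ∣`. It can fail if a new element is a loop in neither extension, so
  -- it is left to the concrete `R₁` and `R₂`.
  amalgam : (∀ S → σ S ≤ ∣ S ∣ + r S) → Matroid (n + k)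
  amalgam bound = record
    { rk        = min⊇ η
    ; rk-bound  = λ S → ≤-trans (min⊇-lower η ⊆-refl)
                    (+-cancelʳ-≤ (r S) _ _ (≤-trans (≤-reflexive (η+r S)) (bound S)))
    ; rk-mono   = λ A B A⊆B → let W , B⊆W , eq = min⊇-attained η B in
                    ≤-trans (min⊇-lower η (⊆-trans A⊆B B⊆W)) (≤-reflexive eq)
    ; rk-submod = ζ-submod
    }

  -- At `S` itself `r` cancels `rk R₂`. Any superset `W` has `r W ≤ rk R₂ W`, so `η W` is at least
  -- `rk R₁ W`.
  ζ≡rk₁ : ∀ S → rk R₂ S ≡ r S → min⊇ η S ≡ rk R₁ S
  ζ≡rk₁ S eq = ≤-antisym
    (≤-trans (min⊇-lower η ⊆-refl) (+-cancelʳ-≤ (r S) _ _ (≤-reflexive (trans (η+r S) (cong (rk R₁ S +_) eq)))))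
    (let W , S⊆W , min = min⊇-attained η S in begin
      rk R₁ S ≤⟨ rk-mono R₁ _ _ S⊆W ⟩
      rk R₁ W ≤⟨ +-cancelʳ-≤ (r W) _ _ (≤-trans (+-monoʳ-≤ (rk R₁ W) (E₂.rk-τ≤ W)) (≤-reflexive (sym (η+r W)))) ⟩
      η W     ≡⟨ min ⟩
      min⊇ η S ∎)
    where open ≤-Reasoning

  ζ≡rk₂ : ∀ S → rk R₁ S ≡ r S → min⊇ η S ≡ rk R₂ S
  ζ≡rk₂ S eq = ≤-antisym
    (≤-trans (min⊇-lower η ⊆-refl) (+-cancelʳ-≤ (r S) _ _ (≤-reflexive
      (trans (η+r S) (trans (cong (_+ rk R₂ S) eq) (+-comm (r S) _))))))
    (let W , S⊆W , min = min⊇-attained η S in begin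
      rk R₂ S ≤⟨ rk-mono R₂ _ _ S⊆W ⟩
      rk R₂ W ≤⟨ +-cancelˡ-≤ (r W) _ _ (≤-trans (+-monoˡ-≤ (rk R₂ W) (E₁.rk-τ≤ W))
                   (≤-reflexive (trans (sym (η+r W)) (+-comm (η W) (r W))))) ⟩
      η W     ≡⟨ min ⟩
      min⊇ η S ∎)
    where open ≤-Reasoning

-- Bringing both extensions to a common ground set.

pullback : ∀ {m m′} (π : Subset m → Subset m′) → (∀ A B → π (A ∪ B) ≡ π A ∪ π B) →
  (∀ A B → π (A ∩ B) ≡ π A ∩ π B) → (∀ A → ∣ π A ∣ ≤ ∣ A ∣) → Matroid m′ → Matroid m
pullback π π-∪ π-∩ π-card N = record
  { rk        = λ A → rk N (π A)
  ; rk-bound  = λ A → ≤-trans (rk-bound N (π A)) (π-card A)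
  ; rk-mono   = λ A B A⊆B → rk-mono N (π A) (π B)
                  (∩≡⇒⊆ (trans (sym (π-∩ A B)) (cong π (⊆⇒∩≡ A⊆B))))
  ; rk-submod = λ A B → subst₂ (λ U I → rk N U + rk N I ≤ rk N (π A) + rk N (π B))
                  (sym (π-∪ A B)) (sym (π-∩ A B)) (rk-submod N (π A) (π B))
  }

module Projections (n k₁ k₂ : ℕ) where

  π₁ : Subset (n + (k₁ + k₂)) → Subset (n + k₁)
  π₁ S = take n S ++ take k₁ (drop n S)

  π₂ : Subset (n + (k₁ + k₂)) → Subset (n + k₂)
  π₂ S = take n S ++ drop k₁ (drop n S)

  π₁-zipWith : ∀ f A B → π₁ (zipWith f A B) ≡ zipWith f (π₁ A) (π₁ B)
  π₁-zipWith f A B = trans (cong₂ _++_ (take-zipWith {m = n} f A B)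
    (trans (cong (take k₁) (drop-zipWith {m = n} f A B)) (take-zipWith {m = k₁} f (drop n A) (drop n B))))
    (sym (zipWith-++ f (take n A) _ (take n B) _))

  π₂-zipWith : ∀ f A B → π₂ (zipWith f A B) ≡ zipWith f (π₂ A) (π₂ B)
  π₂-zipWith f A B = trans (cong₂ _++_ (take-zipWith {m = n} f A B)
    (trans (cong (drop k₁) (drop-zipWith {m = n} f A B)) (drop-zipWith {m = k₁} f (drop n A) (drop n B))))
    (sym (zipWith-++ f (take n A) _ (take n B) _))

  π₁-++ : ∀ A B C → π₁ (A ++ (B ++ C)) ≡ A ++ B
  π₁-++ A B C = cong₂ _++_ (take-++ A (B ++ C)) (trans (cong (take k₁) (drop-++ A (B ++ C))) (take-++ B C))

  π₂-++ : ∀ A B C → π₂ (A ++ (B ++ C)) ≡ A ++ C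
  π₂-++ A B C = cong₂ _++_ (take-++ A (B ++ C)) (trans (cong (drop k₁) (drop-++ A (B ++ C))) (drop-++ B C))

  ∣∣-split : ∀ (S : Subset (n + (k₁ + k₂))) → ∣ take n S ∣ + (∣ take k₁ (drop n S) ∣ + ∣ drop k₁ (drop n S) ∣) ≡ ∣ S ∣
  ∣∣-split S = trans (cong (∣ take n S ∣ +_) (∣take∣+∣drop∣ k₁ (drop n S))) (∣take∣+∣drop∣ n S)
    where
    ∣take∣+∣drop∣ : ∀ m {k} (S : Subset (m + k)) → ∣ take m S ∣ + ∣ drop m S ∣ ≡ ∣ S ∣
    ∣take∣+∣drop∣ m S = trans (sym (∣++∣ (take m S) (drop m S))) (cong ∣_∣ (take++drop≡id m S))

  ∣π₁∣ : ∀ S → ∣ π₁ S ∣ ≤ ∣ S ∣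
  ∣π₁∣ S = subst₂ _≤_ (sym (∣++∣ (take n S) _)) (∣∣-split S) (+-monoʳ-≤ ∣ take n S ∣ (m≤m+n _ _))

  ∣π₂∣ : ∀ S → ∣ π₂ S ∣ ≤ ∣ S ∣
  ∣π₂∣ S = subst₂ _≤_ (sym (∣++∣ (take n S) _)) (∣∣-split S) (+-monoʳ-≤ ∣ take n S ∣ (m≤n+m _ _))

rk-++≤ : ∀ {n k} (N : Matroid (n + k)) A B → rk N (A ++ B) ≤ rk N (A ++ ∅) + ∣ B ∣
rk-++≤ {n} {k} N A B = begin
  rk N (A ++ B)                         ≤⟨ m≤m+n _ _ ⟩
  rk N (A ++ B) + rk N ∅                ≤⟨ submod-⊆ N (⊆-min _) (⊆-min _) A++B⊆ ⟩
  rk N (A ++ ∅) + rk N (∅ {n} ++ B)     ≤⟨ +-monoʳ-≤ (rk N (A ++ ∅)) (rk-bound N _) ⟩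
  rk N (A ++ ∅) + ∣ ∅ {n} ++ B ∣        ≡⟨ cong (rk N (A ++ ∅) +_) (trans (∣++∣ (∅ {n}) B) (cong (_+ ∣ B ∣) (∣⊥∣≡0 n))) ⟩
  rk N (A ++ ∅) + ∣ B ∣                 ∎
  where
  open ≤-Reasoning
  A++B⊆ : A ++ B ⊆ (A ++ ∅) ∪ (∅ ++ B)
  A++B⊆ = ⊆-reflexive (sym (trans (zipWith-++ _ A ∅ ∅ B) (cong₂ _++_ (∪-identityʳ A) (∪-identityˡ B))))

theorem5 : ∀ (n : ℕ) (M : Matroid n) → rank M ≡ 4 → OTE M → Sticky M
theorem5 n M rank4 ote k₁ k₂ N₁ N₂ ext₁ ext₂ = amalgam bound , restrict₁ , restrict₂
  where
  open Projections n k₁ k₂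

  R₁ R₂ : Matroid (n + (k₁ + k₂))
  -- Each projection forgets the new elements of the other extension, which thereby become loops.
  R₁ = pullback π₁ (π₁-zipWith _) (π₁-zipWith _) ∣π₁∣ N₁
  R₂ = pullback π₂ (π₂-zipWith _) (π₂-zipWith _) ∣π₂∣ N₂

  ∅-++ : ∀ k₁ {k₂} → ∅ {k₁ + k₂} ≡ ∅ {k₁} ++ ∅ {k₂}
  ∅-++ zero     = refl
  ∅-++ (suc k₁) = cong (outside ∷_) (∅-++ k₁)

  R₁-τ : ∀ A C → rk R₁ (A ++ (∅ ++ C)) ≡ rk M A
  R₁-τ A C = trans (cong (rk N₁) (π₁-++ A ∅ C)) (ext₁ A)

  R₂-τ : ∀ A B → rk R₂ (A ++ (B ++ ∅)) ≡ rk M A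
  R₂-τ A B = trans (cong (rk N₂) (π₂-++ A B ∅)) (ext₂ A)

  open Amalgam M ote rank4 R₁ R₂
    (λ A → trans (cong (λ Z → rk R₁ (A ++ Z)) (∅-++ k₁)) (R₁-τ A ∅))
    (λ A → trans (cong (λ Z → rk R₂ (A ++ Z)) (∅-++ k₁)) (R₂-τ A ∅))

  bound : ∀ S → σ S ≤ ∣ S ∣ + r S
  bound S = begin
    -- The trace `A` is counted once by its rank, to match `r S`, and once by its size.
    rk N₁ (A ++ B) + rk N₂ (A ++ C)     ≤⟨ +-mono-≤ (rk-++≤ N₁ A B) (rk-bound N₂ (A ++ C)) ⟩
    rk N₁ (A ++ ∅) + ∣ B ∣ + ∣ A ++ C ∣ ≡⟨ cong₂ (λ a c → a + ∣ B ∣ + c) (ext₁ A) (∣++∣ A C) ⟩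
    rk M A + ∣ B ∣ + (∣ A ∣ + ∣ C ∣)    ≡⟨ shuffle (rk M A) (∣ A ∣) (∣ B ∣) (∣ C ∣) ⟩
    ∣ A ∣ + (∣ B ∣ + ∣ C ∣) + rk M A    ≡⟨ cong (_+ rk M A) (∣∣-split S) ⟩
    ∣ S ∣ + r S                         ∎
    where
    open ≤-Reasoning
    A = take n S
    B = take k₁ (drop n S)
    C = drop k₁ (drop n S)
    shuffle : ∀ r a b c → r + b + (a + c) ≡ a + (b + c) + r
    shuffle = solve-∀

  restrict₁ : ∀ Y Z → rk (amalgam bound) (Y ++ (Z ++ ∅)) ≡ rk N₁ (Y ++ Z)
  restrict₁ Y Z = trans
    (ζ≡rk₁ (Y ++ (Z ++ ∅)) (trans (R₂-τ Y Z) (cong (rk M) (sym (take-++ Y (Z ++ ∅))))))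
    (cong (rk N₁) (π₁-++ Y Z ∅))

  restrict₂ : ∀ Y Z → rk (amalgam bound) (Y ++ (∅ ++ Z)) ≡ rk N₂ (Y ++ Z)
  restrict₂ Y Z = trans
    (ζ≡rk₂ (Y ++ (∅ ++ Z)) (trans (R₁-τ Y Z) (cong (rk M) (sym (take-++ Y (∅ ++ Z))))))
    (cong (rk N₂) (π₂-++ Y ∅ Z))
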